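{- There exist real constants $c_1$ and $c_2$ with $0<c_1<c_2<1$ such that, for all sufficiently large positive integers $n$, $$c_1 f_1(n)\le f_4(n)\le c_2 f_1(n),$$ where $$f_1(n)=2(n-2)\left(\frac{n(n-3)}{2}+1\right)^2$$ and $$f_4(n)=2\sum_{k=0}^{n-3}\ \sum_{N=0}^{A_n(k)-1}\bigl(M'(N,k)+1\bigr),\qquad A_n(k)=\min\left\{k(n-1)+1,\ \left\lfloor \frac{n^2+5}{2}-2n\right\rfloor\right\}.$$
   Context: The function $M'(N,k)$ is a nonnegative integer function of integers $N\ge 0$, $k\ge 0$, given as follows. If $N=0$ or $k=0$, then $M'(N,k)=0$. If $N,k\ge 1$, let $q=\lfloor N/k\rfloor$ and $r=N \bmod k$ (so $N=qk+r$, $0\le r<k$). Then: - if $k<q$, $M'(N,k)=0$; - if $k\ge q$ and $r\le q$ (including $r=0$), $M'(N,k)=q(k-q+1)-r$; - if $k\ge q$ and $r>q$, $M'(N,k)=q(k-q-1)+r$. Background on the meaning of these quantities (not needed to read the inequality). $f_1(n)$ is the number of elements of the four dimensional array, with dimension sizes $\frac{n(n-3)}{2}+1$, $n-2$, $2$, $\frac{n(n-3)}{2}+1$, used by an earlier dynamic programming algorithm computing the number $L(n)$ of zero-free graphical degree sequences of length $n$ with largest part less than $n-1$. $f_4(n)$ is the number of elements of the ragged four dimensional array $Q$ used by the improved algorithm: its first dimension has size $2$; its second dimension (index $k$, starting at $0$) has size $n-2$; its third dimension (index $N$, starting at $0$) has size $A_n(k)$; its fourth dimension has size $M'(N,k)+1$.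 Thus $f_4(n)$ is the displayed sum. -}

module Defs where

open import Data.Bool using (if_then_else_)
open import Data.Integer using (+_)
open import Data.List using (applyUpTo)
open import Data.Nat as ℕ using (ℕ; zero; suc; _+_; _*_; _^_; _∸_; _⊓_; _/_; _%_; _<?_; _≤?_)
import Data.Nat.Properties as ℕ
open import Data.Nat.ListAction using (sum)
open import Data.Product using (∃-syntax; _×_; _,_)
open import Data.Rational as ℚ using (ℚ; 0ℚ; 1ℚ; ∣_∣; Positive; NonNegative; NonZero)
import Data.Rational.Properties as ℚ
open import Relation.Binary.PropositionalEquality using (_≡_; refl; sym; cong; cong₂; subst; module ≡-Reasoning)
open import Relation.Nullary using (does)

-- Real numbers as Cauchy sequences of rationals.  Two sequences represent the
-- same real when their difference tends to zero; _<ᵣ_, _≤ᵣ_ and _*ᵣ_ respect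
-- that relation, so no quotient is taken.

IsCauchy : (ℕ → ℚ) → Set
IsCauchy x = ∀ ε → 0ℚ ℚ.< ε →
  ∃[ N ] (∀ m n → N ℕ.≤ m → N ℕ.≤ n → ∣ x m ℚ.- x n ∣ ℚ.< ε)

record ℝ : Set where
  constructor mkℝ
  field
    seq      : ℕ → ℚ
    isCauchy : IsCauchy seq

open ℝ public

infix 4 _<ᵣ_ _≤ᵣ_
infixl 7 _*ᵣ_

_<ᵣ_ : ℝ → ℝ → Set
x <ᵣ y = ∃[ ε ] (0ℚ ℚ.< ε × ∃[ N ] (∀ n → N ℕ.≤ n → seq x n ℚ.+ ε ℚ.≤ seq y n))

_≤ᵣ_ : ℝ → ℝ → Set
x ≤ᵣ y = ∀ ε → 0ℚ ℚ.< ε → ∃[ N ] (∀ n → N ℕ.≤ n → seq x n ℚ.≤ seq y n ℚ.+ ε)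

fromℚ : ℚ → ℝ
fromℚ q = mkℝ (λ _ → q) λ ε 0<ε →
  0 , λ _ _ _ _ → subst (λ d → ∣ d ∣ ℚ.< ε) (sym (ℚ.+-inverseʳ q)) 0<ε

fromℕ : ℕ → ℝ
fromℕ n = fromℚ (+ n ℚ./ 1)

0ᵣ 1ᵣ : ℝ
0ᵣ = fromℚ 0ℚ
1ᵣ = fromℚ 1ℚ

private
  open import Algebra.Properties.Group ℚ.+-0-group using (//-rightDividesˡ)
  open import Algebra.Properties.Ring ℚ.+-*-ring using (x[y-z]≈xy-xz; [y-z]x≈yx-zx)

  0<1 : 0ℚ ℚ.< 1ℚ
  0<1 = ℚ.positive⁻¹ 1ℚ

  split : ∀ a b → a ≡ b ℚ.+ (a ℚ.- b)
  split a b = begin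
    a                          ≡⟨ //-rightDividesˡ b a ⟨
    (a ℚ.- b) ℚ.+ b            ≡⟨ ℚ.+-comm (a ℚ.- b) b ⟩
    b ℚ.+ (a ℚ.- b)            ∎
    where open ≡-Reasoning

  telescope : ∀ a b c → a ℚ.- c ≡ (a ℚ.- b) ℚ.+ (b ℚ.- c)
  telescope a b c = begin
    a ℚ.- c                            ≡⟨ cong (ℚ._- c) (//-rightDividesˡ b a) ⟨
    ((a ℚ.- b) ℚ.+ b) ℚ.- c            ≡⟨ ℚ.+-assoc (a ℚ.- b) b (ℚ.- c) ⟩
    (a ℚ.- b) ℚ.+ (b ℚ.- c)            ∎
    where open ≡-Reasoning

  split-* : ∀ a b c d →
    a ℚ.* c ℚ.- b ℚ.* d ≡ a ℚ.* (c ℚ.- d) ℚ.+ d ℚ.* (a ℚ.- b)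
  split-* a b c d = begin
    a ℚ.* c ℚ.- b ℚ.* d
      ≡⟨ telescope (a ℚ.* c) (a ℚ.* d) (b ℚ.* d) ⟩
    (a ℚ.* c ℚ.- a ℚ.* d) ℚ.+ (a ℚ.* d ℚ.- b ℚ.* d)
      ≡⟨ cong₂ ℚ._+_ (x[y-z]≈xy-xz a c d) ([y-z]x≈yx-zx d a b) ⟨
    a ℚ.* (c ℚ.- d) ℚ.+ (a ℚ.- b) ℚ.* d
      ≡⟨ cong (a ℚ.* (c ℚ.- d) ℚ.+_) (ℚ.*-comm (a ℚ.- b) d) ⟩
    a ℚ.* (c ℚ.- d) ℚ.+ d ℚ.* (a ℚ.- b) ∎
    where open ≡-Reasoning

  eventuallyBounded : ∀ {x} → IsCauchy x →
    ∃[ B ] (Positive B × ∃[ N ] (∀ n → N ℕ.≤ n → ∣ x n ∣ ℚ.≤ B))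
  eventuallyBounded {x} cx with cx 1ℚ 0<1
  ... | N , close = ∣ x N ∣ ℚ.+ 1ℚ
      , ℚ.nonNeg+pos⇒pos ∣ x N ∣ {{ℚ.∣-∣-nonNeg (x N)}} 1ℚ
      , N , λ n N≤n → begin
          ∣ x n ∣                          ≡⟨ cong ∣_∣ (split (x n) (x N)) ⟩
          ∣ x N ℚ.+ (x n ℚ.- x N) ∣        ≤⟨ ℚ.∣p+q∣≤∣p∣+∣q∣ (x N) (x n ℚ.- x N) ⟩
          ∣ x N ∣ ℚ.+ ∣ x n ℚ.- x N ∣      ≤⟨ ℚ.+-monoʳ-≤ ∣ x N ∣ (ℚ.<⇒≤ (close n N N≤n ℕ.≤-refl)) ⟩
          ∣ x N ∣ ℚ.+ 1ℚ                   ∎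
    where open ℚ.≤-Reasoning

  *-bound : ∀ {p q B δ} → Positive B → ∣ p ∣ ℚ.≤ B → ∣ q ∣ ℚ.< δ →
    ∣ p ℚ.* q ∣ ℚ.< B ℚ.* δ
  *-bound {p} {q} {B} {δ} B>0 p≤B q<δ = begin-strict
    ∣ p ℚ.* q ∣        ≡⟨ ℚ.∣p*q∣≡∣p∣*∣q∣ p q ⟩
    ∣ p ∣ ℚ.* ∣ q ∣    ≤⟨ ℚ.*-monoʳ-≤-nonNeg ∣ q ∣ {{ℚ.∣-∣-nonNeg q}} p≤B ⟩
    B ℚ.* ∣ q ∣        <⟨ ℚ.*-monoʳ-<-pos B {{B>0}} q<δ ⟩
    B ℚ.* δ            ∎
    where open ℚ.≤-Reasoning

  *-isCauchy : ∀ {x y} → IsCauchy x → IsCauchy y → IsCauchy (λ n → x n ℚ.* y n)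
  *-isCauchy {x} {y} cx cy ε 0<ε
    with eventuallyBounded {x} cx | eventuallyBounded {y} cy
  ... | A , A>0 , N₁ , x≤A | B , B>0 , N₂ , y≤B = helper
    where
    instance
      C>0 : Positive (A ℚ.+ B)
      C>0 = ℚ.pos+pos⇒pos A {{A>0}} B {{B>0}}

      C≢0 : NonZero (A ℚ.+ B)
      C≢0 = ℚ.pos⇒nonZero (A ℚ.+ B)

      1/C>0 : Positive (ℚ.1/ (A ℚ.+ B))
      1/C>0 = ℚ.1/pos⇒pos (A ℚ.+ B)

      ε>0 : Positive ε
      ε>0 = ℚ.positive 0<ε

    δ : ℚ
    δ = ℚ.1/ (A ℚ.+ B) ℚ.* ε

    0<δ : 0ℚ ℚ.< δ
    0<δ = ℚ.positive⁻¹ δ {{ℚ.pos*pos⇒pos (ℚ.1/ (A ℚ.+ B)) ε}}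

    Aδ+Bδ≡ε : A ℚ.* δ ℚ.+ B ℚ.* δ ≡ ε
    Aδ+Bδ≡ε = begin
      A ℚ.* δ ℚ.+ B ℚ.* δ                          ≡⟨ ℚ.*-distribʳ-+ δ A B ⟨
      (A ℚ.+ B) ℚ.* δ                              ≡⟨ ℚ.*-assoc (A ℚ.+ B) (ℚ.1/ (A ℚ.+ B)) ε ⟨
      (A ℚ.+ B) ℚ.* (ℚ.1/ (A ℚ.+ B)) ℚ.* ε         ≡⟨ cong (ℚ._* ε) (ℚ.*-inverseʳ (A ℚ.+ B)) ⟩
      1ℚ ℚ.* ε                                     ≡⟨ ℚ.*-identityˡ ε ⟩
      ε                                            ∎
      where open ≡-Reasoning

    close : ∀ m n → ∣ x m ∣ ℚ.≤ A → ∣ y n ∣ ℚ.≤ B →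
      ∣ x m ℚ.- x n ∣ ℚ.< δ → ∣ y m ℚ.- y n ∣ ℚ.< δ →
      ∣ x m ℚ.* y m ℚ.- x n ℚ.* y n ∣ ℚ.< ε
    close m n xm≤A yn≤B dx<δ dy<δ = begin-strict
      ∣ x m ℚ.* y m ℚ.- x n ℚ.* y n ∣
        ≡⟨ cong ∣_∣ (split-* (x m) (x n) (y m) (y n)) ⟩
      ∣ x m ℚ.* (y m ℚ.- y n) ℚ.+ y n ℚ.* (x m ℚ.- x n) ∣
        ≤⟨ ℚ.∣p+q∣≤∣p∣+∣q∣ (x m ℚ.* (y m ℚ.- y n)) (y n ℚ.* (x m ℚ.- x n)) ⟩
      ∣ x m ℚ.* (y m ℚ.- y n) ∣ ℚ.+ ∣ y n ℚ.* (x m ℚ.- x n) ∣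
        <⟨ ℚ.+-mono-< (*-bound {x m} {y m ℚ.- y n} A>0 xm≤A dy<δ)
                      (*-bound {y n} {x m ℚ.- x n} B>0 yn≤B dx<δ) ⟩
      A ℚ.* δ ℚ.+ B ℚ.* δ
        ≡⟨ Aδ+Bδ≡ε ⟩
      ε ∎
      where open ℚ.≤-Reasoning

    helper : ∃[ N ] (∀ m n → N ℕ.≤ m → N ℕ.≤ n →
      ∣ x m ℚ.* y m ℚ.- x n ℚ.* y n ∣ ℚ.< ε)
    helper with cx δ 0<δ | cy δ 0<δ
    ... | N₃ , closeˣ | N₄ , closeʸ = N₁₂ ℕ.⊔ N₃₄ , λ m n N≤m N≤n →
      close m n
        (x≤A m (ℕ.m⊔n≤o⇒m≤o N₁ N₂ (ℕ.m⊔n≤o⇒m≤o N₁₂ N₃₄ N≤m)))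
        (y≤B n (ℕ.m⊔n≤o⇒n≤o N₁ N₂ (ℕ.m⊔n≤o⇒m≤o N₁₂ N₃₄ N≤n)))
        (closeˣ m n (ℕ.m⊔n≤o⇒m≤o N₃ N₄ (ℕ.m⊔n≤o⇒n≤o N₁₂ N₃₄ N≤m))
                    (ℕ.m⊔n≤o⇒m≤o N₃ N₄ (ℕ.m⊔n≤o⇒n≤o N₁₂ N₃₄ N≤n)))
        (closeʸ m n (ℕ.m⊔n≤o⇒n≤o N₃ N₄ (ℕ.m⊔n≤o⇒n≤o N₁₂ N₃₄ N≤m))
                    (ℕ.m⊔n≤o⇒n≤o N₃ N₄ (ℕ.m⊔n≤o⇒n≤o N₁₂ N₃₄ N≤n)))
      where
      N₁₂ N₃₄ : ℕ
      N₁₂ = N₁ ℕ.⊔ N₂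
      N₃₄ = N₃ ℕ.⊔ N₄

_*ᵣ_ : ℝ → ℝ → ℝ
x *ᵣ y = mkℝ (λ n → seq x n ℚ.* seq y n) (*-isCauchy {seq x} {seq y} (isCauchy x) (isCauchy y))

-- No subtraction here truncates: the second branch has r ≤ q ≤ k, hence
-- r ≤ q (k - q + 1); the third has q < r < k.
M′ : ℕ → ℕ → ℕ
M′ zero      _         = 0
M′ (suc _)   zero      = 0
M′ N@(suc _) k@(suc _) =
  let q = N / k
      r = N % k
  in if does (k <? q) then 0
     else if does (r ≤? q) then q * (k ∸ q + 1) ∸ r
     else q * (k ∸ q ∸ 1) + r

-- n (n - 3) is always even, so for n ≥ 3 the division is exact and no
-- subtraction truncates.
f₁ : ℕ → ℕ
f₁ n = 2 * (n ∸ 2) * (n * (n ∸ 3) / 2 + 1) ^ 2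

-- ⌊(n² + 5)/2 - 2n⌋ = ⌊(n² + 5 - 4n)/2⌋, where n² + 5 - 4n = (n - 2)² + 1 > 0.
A : ℕ → ℕ → ℕ
A n k = (k * (n ∸ 1) + 1) ⊓ ((n ^ 2 + 5 ∸ 4 * n) / 2)

∑< : ℕ → (ℕ → ℕ) → ℕ
∑< m g = sum (applyUpTo g m)

-- For n ≥ 2 the outer range 0 ≤ k ≤ n - 3 is k < n - 2.
f₄ : ℕ → ℕ
f₄ n = 2 * ∑< (n ∸ 2) (λ k → ∑< (A n k) (λ N → M′ N k + 1))

{-# OPTIONS --safe #-}

-- Write q = ⌊N/k⌋.  In every case q (k ∸ q) ≤ M′ N k ≤ (k + 1)²/4.  The upper
-- bound makes each of the inner terms of f₄ at most 3/4 of n (n - 3)/2 + 1,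
-- which also bounds their number A n k, so f₄ n ≤ 3/4 f₁ n.  For the lower bound
-- put h = ⌊(n - 2)/8⌋: when 4h ≤ k < 8h and hk ≤ N < 2hk we have h ≤ q < 2h, so
-- M′ N k ≥ 2h², and there are at least 16h³ such pairs (k , N), so f₄ n ≥ 64h⁵.
-- If n ≥ 10 then n - 2 ≤ 15h, whence f₁ n ≤ 2 (15h) (120h²)² = 6750 · 64h⁵.

module Submission where

open import Defs
open import Data.Bool using (if_then_else_)
open import Data.Integer as ℤ using (+_)
import Data.Integer.Properties as ℤ
open import Data.Nat using (ℕ; _≤_; zero; suc; _+_; _*_; _^_; _∸_; _/_; _%_; _<_; _<?_; _≤?_; NonZero; z≤n; s≤s; z<s)
open import Data.Nat.DivMod using (/-monoˡ-≤; m*n/n≡m; m/n*n≤m; m<n*o⇒m/o<n; m%n<n; m%n≤n; m≡m%n+[m/n]*n; +-distrib-/-∣ʳ)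
open import Data.Nat.Divisibility using (∣-refl)
open import Data.Nat.Properties
open import Data.Nat.Tactic.RingSolver using (solve-∀)
open import Data.Product using (Σ-syntax; ∃-syntax; _×_; _,_)
open import Data.Rational as ℚ using (0ℚ)
import Data.Rational.Properties as ℚ
open import Data.Rational.Unnormalised as ℚᵘ using (mkℚᵘ)
import Data.Rational.Unnormalised.Properties as ℚᵘ
open import Data.Sum using (inj₁; inj₂)
open import Function using (_∘_)
open import Relation.Binary.PropositionalEquality using (_≡_; refl; sym; trans; cong; subst; subst₂)
open import Relation.Nullary using (Dec; yes; no; does)
open import Relation.Nullary.Decidable using (from-yes)

-- Elementary inequalities and finite sums.

-- Reduces a polynomial inequality to an identity: once the slack `e` is named, the ring solver can
-- check the rest.
m+e≡n⇒m≤n : ∀ {m n} e → m + e ≡ n → m ≤ n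
m+e≡n⇒m≤n {m} e eq = m+n≤o⇒m≤o m (≤-reflexive eq)

m<n⇒∃[o]m+1+o≡n : ∀ {m n} → m < n → ∃[ o ] m + suc o ≡ n
m<n⇒∃[o]m+1+o≡n {m} m<n with m≤n⇒∃[o]m+o≡n m<n
... | o , eq = o , trans (+-suc m o) eq

-- The difference of the two sides is the square of `a - b`. Ordering `a` and `b` first lets that
-- difference be a natural number `e`.
amgm : ∀ a b → 4 * (a * b) ≤ (a + b) * (a + b)
amgm a b with ≤-total a b
... | inj₁ a≤b with m≤n⇒∃[o]m+o≡n a≤b
...   | e , refl = m+e≡n⇒m≤n (e * e) (identity a e)
  where
  identity : ∀ a e → 4 * (a * (a + e)) + e * e ≡ (a + (a + e)) * (a + (a + e))
  identity = solve-∀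
amgm a b | inj₂ b≤a with m≤n⇒∃[o]m+o≡n b≤a
...   | e , refl = m+e≡n⇒m≤n (e * e) (identity b e)
  where
  identity : ∀ b e → 4 * ((b + e) * b) + e * e ≡ (b + e + b) * (b + e + b)
  identity = solve-∀

-- The factor `b` stays on the left so that a bound with denominator `b` can be stated without
-- division.
∑<-upper : ∀ b m g c → (∀ i → i < m → b * g i ≤ c) → b * ∑< m g ≤ m * c
∑<-upper b zero    g c b*g≤c = ≤-reflexive (*-zeroʳ b)
∑<-upper b (suc m) g c b*g≤c = begin
  b * (g 0 + ∑< m (g ∘ suc))          ≡⟨ *-distribˡ-+ b (g 0) (∑< m (g ∘ suc)) ⟩
  b * g 0 + b * ∑< m (g ∘ suc)        ≤⟨ +-mono-≤ (b*g≤c 0 z<s) (∑<-upper b m (g ∘ suc) c (λ i i<m → b*g≤c (suc i) (s≤s i<m))) ⟩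
  c + m * c                           ∎
  where open ≤-Reasoning

∑<-lower : ∀ a d m g c → a + d ≤ m → (∀ i → a ≤ i → i < a + d → c ≤ g i) → d * c ≤ ∑< m g
∑<-lower zero    zero    m       g c _         c≤g = z≤n
∑<-lower zero    (suc d) (suc m) g c (s≤s d≤m) c≤g =
  +-mono-≤ (c≤g 0 z≤n z<s)
           (∑<-lower zero d m (g ∘ suc) c d≤m (λ i _ i<d → c≤g (suc i) z≤n (s≤s i<d)))
∑<-lower (suc a) d       (suc m) g c (s≤s a+d≤m) c≤g =
  m≤n⇒m≤o+n (g 0)
    (∑<-lower a d m (g ∘ suc) c a+d≤m (λ i a≤i i<a+d → c≤g (suc i) (s≤s a≤i) (s≤s i<a+d)))

-- Bounds for `M′`.

-- The deciders are abstract because with-abstraction cannot see k <? q and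
-- r ≤? q inside the unfolded M′.
M′-cases : ∀ {q k r} → Dec (k < q) → Dec (r ≤ q) → ℕ
M′-cases {q} {k} {r} k<q? r≤q? =
  if does k<q? then 0
  else if does r≤q? then q * (k ∸ q + 1) ∸ r
  else q * (k ∸ q ∸ 1) + r

-- If `k < q`, truncation makes `k ∸ q` zero. If `r ≤ q`, replacing the subtracted `r` by `q` leaves
-- exactly `q * (k ∸ q)`. Otherwise `q < r < k`, so `k = q + suc d`, and the added `r` makes up for
-- the missing `q`.
M′-cases-lower : ∀ {q k r} → r < k → (k<q? : Dec (k < q)) (r≤q? : Dec (r ≤ q)) →
  q * (k ∸ q) ≤ M′-cases k<q? r≤q?
M′-cases-lower {q} {k} r<k (yes k<q) _
  rewrite m≤n⇒m∸n≡0 (<⇒≤ k<q) | *-zeroʳ q = z≤n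
M′-cases-lower {q} {k} {r} r<k (no _) (yes r≤q) = begin
  q * (k ∸ q)              ≡⟨ m+n∸n≡m (q * (k ∸ q)) q ⟨
  q * (k ∸ q) + q ∸ q      ≡⟨ cong (_∸ q) (identity q (k ∸ q)) ⟩
  q * (k ∸ q + 1) ∸ q      ≤⟨ ∸-monoʳ-≤ (q * (k ∸ q + 1)) r≤q ⟩
  q * (k ∸ q + 1) ∸ r      ∎
  where
  open ≤-Reasoning
  identity : ∀ q d → q * d + q ≡ q * (d + 1)
  identity = solve-∀
M′-cases-lower {q} {k} {r} r<k (no _) (no r≰q)
  with m<n⇒∃[o]m+1+o≡n (<-trans (≰⇒> r≰q) r<k)
... | d , refl rewrite m+n∸m≡n q (suc d) = begin
  q * suc d      ≡⟨ *-suc q d ⟩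
  q + q * d      ≡⟨ +-comm q (q * d) ⟩
  q * d + q      ≤⟨ +-monoʳ-≤ (q * d) (<⇒≤ (≰⇒> r≰q)) ⟩
  q * d + r      ∎
  where open ≤-Reasoning

-- When `r ≤ q`, `amgm` is applied to factors with sum `k + 1`. When `r > q`, the factors `q` and
-- `d` have sum `k - 1`, and the remaining `4 * r` is covered because `(k - 1)² + 4k = (k + 1)²`.
M′-cases-upper : ∀ {q k r} → r < k → (k<q? : Dec (k < q)) (r≤q? : Dec (r ≤ q)) →
  4 * M′-cases k<q? r≤q? ≤ suc k * suc k
M′-cases-upper r<k (yes _) _ = z≤n
M′-cases-upper {q} {k} {r} r<k (no k≮q) (yes _) with m≤n⇒∃[o]m+o≡n (≮⇒≥ k≮q)
... | d , refl rewrite m+n∸m≡n q d = begin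
  4 * (q * (d + 1) ∸ r)              ≤⟨ *-monoʳ-≤ 4 (m∸n≤m (q * (d + 1)) r) ⟩
  4 * (q * (d + 1))                  ≤⟨ amgm q (d + 1) ⟩
  (q + (d + 1)) * (q + (d + 1))      ≡⟨ identity q d ⟩
  suc (q + d) * suc (q + d)          ∎
  where
  open ≤-Reasoning
  identity : ∀ q d → (q + (d + 1)) * (q + (d + 1)) ≡ suc (q + d) * suc (q + d)
  identity = solve-∀
M′-cases-upper {q} {k} {r} r<k (no _) (no r≰q)
  with m<n⇒∃[o]m+1+o≡n (<-trans (≰⇒> r≰q) r<k)
... | d , refl rewrite m+n∸m≡n q (suc d) = begin
  4 * (q * d + r)                            ≡⟨ *-distribˡ-+ 4 (q * d) r ⟩
  4 * (q * d) + 4 * r                        ≤⟨ +-mono-≤ (amgm q d) (*-monoʳ-≤ 4 (<⇒≤ r<k)) ⟩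
  (q + d) * (q + d) + 4 * (q + suc d)        ≡⟨ identity q d ⟩
  suc (q + suc d) * suc (q + suc d)          ∎
  where
  open ≤-Reasoning
  identity : ∀ q d → (q + d) * (q + d) + 4 * (q + suc d) ≡ suc (q + suc d) * suc (q + suc d)
  identity = solve-∀

M′-lower : ∀ N k .{{_ : NonZero k}} → (N / k) * (k ∸ N / k) ≤ M′ N k
M′-lower zero      (suc _)   = z≤n
M′-lower N@(suc _) k@(suc _) = M′-cases-lower (m%n<n N k) (k <? N / k) (N % k ≤? N / k)

M′-upper : ∀ N k → 4 * M′ N k ≤ suc k * suc k
M′-upper zero      _         = z≤n
M′-upper (suc _)   zero      = z≤n
M′-upper N@(suc _) k@(suc _) = M′-cases-upper (m%n<n N k) (k <? N / k) (N % k ≤? N / k)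

-- Array dimensions and the upper bound for `f₄`.

cap : ∀ m → ((2 + m) ^ 2 + 5 ∸ 4 * (2 + m)) ≡ m * m + 1
cap m = trans (cong (_∸ 4 * (2 + m)) (identity m)) (m+n∸n≡m (m * m + 1) (4 * (2 + m)))
  where
  identity : ∀ m → (2 + m) * ((2 + m) * 1) + 5 ≡ m * m + 1 + 4 * (2 + m)
  identity = solve-∀

side : ℕ → ℕ
side n = n * (n ∸ 3) / 2 + 1

-- Only the second argument of the minimum matters here. The `+ 1` of `side` enters the halving as
-- `+ 2`, and the two numerators then differ by `p`.
A≤side : ∀ p k → A (3 + p) k ≤ side (3 + p)
A≤side p k = begin
  A (3 + p) k                     ≤⟨ m⊓n≤n (k * (2 + p) + 1) _ ⟩
  ((3 + p) ^ 2 + 5 ∸ 4 * (3 + p)) / 2  ≡⟨ cong (_/ 2) (cap (suc p)) ⟩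
  (suc p * suc p + 1) / 2         ≤⟨ /-monoˡ-≤ 2 (m+e≡n⇒m≤n p (identity p)) ⟩
  ((3 + p) * p + 2) / 2           ≡⟨ +-distrib-/-∣ʳ ((3 + p) * p) ∣-refl ⟩
  side (3 + p)                    ∎
  where
  open ≤-Reasoning
  identity : ∀ p → suc p * suc p + 1 + p ≡ (3 + p) * p + 2
  identity = solve-∀

2*side-upper : ∀ p → 2 * side (3 + p) ≤ suc p * suc (suc p)
2*side-upper p = begin
  2 * ((3 + p) * p / 2 + 1)     ≡⟨ identity₁ ((3 + p) * p / 2) ⟩
  (3 + p) * p / 2 * 2 + 2       ≤⟨ +-monoˡ-≤ 2 (m/n*n≤m ((3 + p) * p) 2) ⟩
  (3 + p) * p + 2               ≡⟨ identity₂ p ⟩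
  suc p * suc (suc p)           ∎
  where
  open ≤-Reasoning
  identity₁ : ∀ x → 2 * (x + 1) ≡ x * 2 + 2
  identity₁ = solve-∀
  identity₂ : ∀ p → (3 + p) * p + 2 ≡ suc p * suc (suc p)
  identity₂ = solve-∀

-- No parity argument is made: the remainder modulo 2 is absorbed by the 2 that the `+ 1` in `side`
-- contributes after doubling.
2*side-lower : ∀ p → (3 + p) * p ≤ 2 * side (3 + p)
2*side-lower p = begin
  (3 + p) * p                                      ≡⟨ m≡m%n+[m/n]*n ((3 + p) * p) 2 ⟩
  (3 + p) * p % 2 + (3 + p) * p / 2 * 2            ≤⟨ +-monoˡ-≤ _ (m%n≤n ((3 + p) * p) 2) ⟩
  2 + (3 + p) * p / 2 * 2                          ≡⟨ identity ((3 + p) * p / 2) ⟩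
  2 * side (3 + p)                                 ∎
  where
  open ≤-Reasoning
  identity : ∀ x → 2 + x * 2 ≡ 2 * (x + 1)
  identity = solve-∀

4*term≤3*side : ∀ p k N → 2 ≤ p → k < suc p → 4 * (M′ N k + 1) ≤ 3 * side (3 + p)
4*term≤3*side p k N 2≤p k<1+p with m≤n⇒∃[o]m+o≡n 2≤p
... | t , refl = *-cancelˡ-≤ 2 (begin
  2 * (4 * (M′ N k + 1))                ≡⟨ identity₁ (M′ N k) ⟩
  2 * (4 * M′ N k) + 8                  ≤⟨ +-monoˡ-≤ 8 (*-monoʳ-≤ 2 (M′-upper N k)) ⟩
  2 * (suc k * suc k) + 8               ≤⟨ +-monoˡ-≤ 8 (*-monoʳ-≤ 2 (*-mono-≤ k<1+p k<1+p)) ⟩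
  -- With `p = 2 + t` the slack is a polynomial in `t` with positive coefficients. At `p = 1` the
  -- inequality fails (16 against 12), whence `2 ≤ p`, that is `n ≥ 5`.
  2 * (suc p * suc p) + 8               ≤⟨ m+e≡n⇒m≤n (t * t + 9 * t + 4) (identity₂ t) ⟩
  3 * ((3 + p) * p)                     ≤⟨ *-monoʳ-≤ 3 (2*side-lower p) ⟩
  3 * (2 * side (3 + p))                ≡⟨ identity₃ (side (3 + p)) ⟩
  2 * (3 * side (3 + p))                ∎)
  where
  open ≤-Reasoning
  identity₁ : ∀ x → 2 * (4 * (x + 1)) ≡ 2 * (4 * x) + 8
  identity₁ = solve-∀
  identity₂ : ∀ t → 2 * (suc (2 + t) * suc (2 + t)) + 8 + (t * t + 9 * t + 4) ≡ 3 * ((3 + (2 + t)) * (2 + t))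
  identity₂ = solve-∀
  identity₃ : ∀ x → 3 * (2 * x) ≡ 2 * (3 * x)
  identity₃ = solve-∀

f₄-upper : ∀ n → 5 ≤ n → 4 * f₄ n ≤ 3 * f₁ n
f₄-upper n 5≤n with m≤n⇒∃[o]m+o≡n (≤-trans (m≤m+n 3 2) 5≤n)
... | p , refl = begin
  4 * (2 * ∑< (suc p) inner)       ≡⟨ identity₁ (∑< (suc p) inner) ⟩
  2 * (4 * ∑< (suc p) inner)       ≤⟨ *-monoʳ-≤ 2 (∑<-upper 4 (suc p) inner (s * (3 * s)) inner-upper) ⟩
  2 * (suc p * (s * (3 * s)))      ≡⟨ identity₂ (suc p) s ⟩
  3 * (2 * suc p * s ^ 2)          ∎
  where
  open ≤-Reasoning
  s : ℕ
  s = side (3 + p)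
  inner : ℕ → ℕ
  inner k = ∑< (A (3 + p) k) (λ N → M′ N k + 1)
  inner-upper : ∀ k → k < suc p → 4 * inner k ≤ s * (3 * s)
  inner-upper k k<1+p = ≤-trans
    (∑<-upper 4 (A (3 + p) k) (λ N → M′ N k + 1) (3 * s) (λ N _ → 4*term≤3*side p k N (+-cancelˡ-≤ 3 2 p 5≤n) k<1+p))
    (*-monoˡ-≤ (3 * s) (A≤side p k))
  identity₁ : ∀ x → 4 * (2 * x) ≡ 2 * (4 * x)
  identity₁ = solve-∀
  identity₂ : ∀ m s → 2 * (m * (s * (3 * s))) ≡ 3 * (2 * m * (s * (s * 1)))
  identity₂ = solve-∀

-- The lower bound for `f₄`.

M′-block-lower : ∀ h k N → 4 * h ≤ k → h * k ≤ N → N < h * k + h * k → 2 * h * h ≤ M′ N k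
-- For `h = 0` the bound is 0. For positive `h`, `4 * h ≤ k` excludes `k = 0`, so division by `k` is
-- defined.
M′-block-lower zero       k          N _    _    _ = z≤n
M′-block-lower h@(suc _)  k@(suc _)  N 4h≤k hk≤N N<2hk = begin
  2 * h * h                  ≡⟨ *-comm (2 * h) h ⟩
  h * (2 * h)                ≤⟨ *-mono-≤ h≤q 2h≤k∸q ⟩
  (N / k) * (k ∸ N / k)      ≤⟨ M′-lower N k ⟩
  M′ N k                     ∎
  where
  open ≤-Reasoning
  h≤q : h ≤ N / k
  h≤q = subst (_≤ N / k) (m*n/n≡m h k) (/-monoˡ-≤ k hk≤N)
  q<2h : N / k < h + h
  q<2h = m<n*o⇒m/o<n (subst (N <_) (sym (*-distribʳ-+ k h h)) N<2hk)
  identity : ∀ h → 2 * h + (h + h) ≡ 4 * h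
  identity = solve-∀
  2h≤k∸q : 2 * h ≤ k ∸ N / k
  2h≤k∸q = m+n≤o⇒m≤o∸n (2 * h)
    (≤-trans (+-monoʳ-≤ (2 * h) (<⇒≤ q<2h)) (≤-trans (≤-reflexive (identity h)) 4h≤k))

-- Ensures that the block of values `N` lies inside the summation range. The first argument of the
-- minimum grows like `8hk`; the second is at least `32h²`, while `2hk` is at most `16h²`.
block-fits : ∀ m h k → 8 * h ≤ m → k < 8 * h → h * k + h * k ≤ A (2 + m) k
block-fits m h k 8h≤m k<8h = ⊓-glb below-first below-second
  where
  open ≤-Reasoning
  identity₁ : ∀ h k → h * k + h * k + (k * (6 * h + 1) + 1) ≡ k * (1 + 8 * h) + 1
  identity₁ = solve-∀
  below-first : h * k + h * k ≤ k * (1 + m) + 1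
  below-first = begin
    h * k + h * k            ≤⟨ m+e≡n⇒m≤n _ (identity₁ h k) ⟩
    k * (1 + 8 * h) + 1      ≤⟨ +-monoˡ-≤ 1 (*-monoʳ-≤ k (s≤s 8h≤m)) ⟩
    k * (1 + m) + 1          ∎
  identity₂ : ∀ h → (h * (8 * h) + h * (8 * h)) * 2 + (32 * (h * h) + 1) ≡ 8 * h * (8 * h) + 1
  identity₂ = solve-∀
  below-second : h * k + h * k ≤ ((2 + m) ^ 2 + 5 ∸ 4 * (2 + m)) / 2
  below-second = begin
    h * k + h * k                               ≤⟨ +-mono-≤ (*-monoʳ-≤ h (<⇒≤ k<8h)) (*-monoʳ-≤ h (<⇒≤ k<8h)) ⟩
    h * (8 * h) + h * (8 * h)                   ≡⟨ m*n/n≡m _ 2 ⟨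
    (h * (8 * h) + h * (8 * h)) * 2 / 2         ≤⟨ /-monoˡ-≤ 2 (m+e≡n⇒m≤n {(h * (8 * h) + h * (8 * h)) * 2} _ (identity₂ h)) ⟩
    (8 * h * (8 * h) + 1) / 2                   ≤⟨ /-monoˡ-≤ 2 (+-monoˡ-≤ 1 (*-mono-≤ 8h≤m 8h≤m)) ⟩
    (m * m + 1) / 2                             ≡⟨ cong (_/ 2) (cap m) ⟨
    ((2 + m) ^ 2 + 5 ∸ 4 * (2 + m)) / 2         ∎

f₄-lower : ∀ m h → 8 * h ≤ m → 64 * h ^ 5 ≤ f₄ (2 + m)
f₄-lower m h 8h≤m = begin
  64 * h ^ 5                                        ≡⟨ identity₁ h ⟩
  -- The factors are the leading 2 of `f₄`, the `4h` values of `k`, at least `4h²` values of `N` for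
  -- each of them, and `2h²` for each term.
  2 * (4 * h * (h * (4 * h) * (2 * h * h)))         ≤⟨ *-monoʳ-≤ 2 (∑<-lower (4 * h) (4 * h) m inner _ 4h+4h≤m inner-lower) ⟩
  f₄ (2 + m)                                        ∎
  where
  open ≤-Reasoning
  inner : ℕ → ℕ
  inner k = ∑< (A (2 + m) k) (λ N → M′ N k + 1)
  4h+4h≡8h : 4 * h + 4 * h ≡ 8 * h
  4h+4h≡8h = sym (*-distribʳ-+ h 4 4)
  4h+4h≤m : 4 * h + 4 * h ≤ m
  4h+4h≤m = ≤-trans (≤-reflexive 4h+4h≡8h) 8h≤m
  inner-lower : ∀ k → 4 * h ≤ k → k < 4 * h + 4 * h → h * (4 * h) * (2 * h * h) ≤ inner k
  inner-lower k 4h≤k k<8h = begin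
    h * (4 * h) * (2 * h * h)      ≤⟨ *-monoˡ-≤ (2 * h * h) (*-monoʳ-≤ h 4h≤k) ⟩
    h * k * (2 * h * h)            ≤⟨ ∑<-lower (h * k) (h * k) (A (2 + m) k) (λ N → M′ N k + 1) (2 * h * h)
                                        (block-fits m h k 8h≤m (subst (k <_) 4h+4h≡8h k<8h))
                                        (λ N hk≤N N<2hk → m≤n⇒m≤n+o 1 (M′-block-lower h k N 4h≤k hk≤N N<2hk)) ⟩
    inner k                        ∎
  identity₁ : ∀ h → 64 * (h * (h * (h * (h * (h * 1))))) ≡ 2 * (4 * h * (h * (4 * h) * (2 * h * h)))
  identity₁ = solve-∀

-- Comparison of `f₁` with `f₄`.

-- The constants a, b, c in the lemmas up to f₁≤c*f₄ are variables because Agda would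
-- unfold a product with a numeral of that size when comparing terms.
side-upper : ∀ p a b h → 1 ≤ h → a * suc a ≡ 2 * b → suc p ≤ a * h → side (3 + p) ≤ b * (h * h)
side-upper p a b h 1≤h eq m≤ah = *-cancelˡ-≤ 2 (begin
  2 * side (3 + p)             ≤⟨ 2*side-upper p ⟩
  -- The extra unit in `suc (suc p)` is paid for by `1 ≤ h`, which gives `suc (suc p) ≤ h + a * h`.
  suc p * suc (suc p)          ≤⟨ *-mono-≤ m≤ah (+-mono-≤ 1≤h m≤ah) ⟩
  a * h * (suc a * h)          ≡⟨ identity a h ⟩
  a * suc a * (h * h)          ≡⟨ cong (_* (h * h)) eq ⟩
  2 * b * (h * h)              ≡⟨ *-assoc 2 b (h * h) ⟩
  2 * (b * (h * h))            ∎)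
  where
  open ≤-Reasoning
  identity : ∀ a h → a * h * (suc a * h) ≡ a * suc a * (h * h)
  identity = solve-∀

f₁-upper : ∀ n a b h → n ∸ 2 ≤ a * h → side n ≤ b * (h * h) → f₁ n ≤ 2 * a * (b * b) * h ^ 5
f₁-upper n a b h m≤ah side≤bh² = begin
  2 * (n ∸ 2) * side n ^ 2              ≤⟨ *-mono-≤ (*-monoʳ-≤ 2 m≤ah) (^-monoˡ-≤ 2 side≤bh²) ⟩
  2 * (a * h) * (b * (h * h)) ^ 2       ≡⟨ identity a b h ⟩
  2 * a * (b * b) * h ^ 5               ∎
  where
  open ≤-Reasoning
  identity : ∀ a b h → 2 * (a * h) * (b * (h * h) * (b * (h * h) * 1)) ≡ 2 * a * (b * b) * (h * (h * (h * (h * (h * 1)))))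
  identity = solve-∀

f₁≤c*f₄ : ∀ n a b c h → 3 ≤ n → 1 ≤ h → 8 * h ≤ n ∸ 2 → n ∸ 2 ≤ a * h →
  a * suc a ≡ 2 * b → 2 * a * (b * b) ≡ c * 64 → 1 * f₁ n ≤ c * f₄ n
f₁≤c*f₄ n a b c h 3≤n 1≤h 8h≤m m≤ah eq₁ eq₂ with m≤n⇒∃[o]m+o≡n 3≤n
... | p , refl = begin
  1 * f₁ (3 + p)                    ≡⟨ *-identityˡ (f₁ (3 + p)) ⟩
  f₁ (3 + p)                        ≤⟨ f₁-upper (3 + p) a b h m≤ah (side-upper p a b h 1≤h eq₁ m≤ah) ⟩
  2 * a * (b * b) * h ^ 5           ≡⟨ cong (_* h ^ 5) eq₂ ⟩
  c * 64 * h ^ 5                    ≡⟨ *-assoc c 64 (h ^ 5) ⟩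
  c * (64 * h ^ 5)                  ≤⟨ *-monoʳ-≤ c (f₄-lower (suc p) h 8h≤m) ⟩
  c * f₄ (3 + p)                    ∎
  where open ≤-Reasoning

f₁≤6750*f₄ : ∀ n → 10 ≤ n → 1 * f₁ n ≤ 6750 * f₄ n
-- Since `m ≤ 8h + 7` and `h ≥ 1`, `a = 15` works. Then `b = 15 * 16 / 2 = 120` and
-- `c = 2 * 15 * 120² / 64 = 6750`; the two `refl` check these equations. The bound `n ≥ 10` is what
-- gives `h ≥ 1`.
f₁≤6750*f₄ n 10≤n = f₁≤c*f₄ n 15 120 6750 h (≤-trans (m≤m+n 3 7) 10≤n) 1≤h 8h≤m m≤15h refl refl
  where
  open ≤-Reasoning
  m h : ℕ
  m = n ∸ 2
  h = m / 8
  1≤h : 1 ≤ h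
  1≤h = /-monoˡ-≤ 8 (∸-monoˡ-≤ 2 10≤n)
  8h≤m : 8 * h ≤ m
  8h≤m = ≤-trans (≤-reflexive (*-comm 8 h)) (m/n*n≤m m 8)
  identity : ∀ h → 7 * h + h * 8 ≡ 15 * h
  identity = solve-∀
  m≤15h : m ≤ 15 * h
  m≤15h = begin
    m                      ≡⟨ m≡m%n+[m/n]*n m 8 ⟩
    m % 8 + h * 8          ≤⟨ +-monoˡ-≤ (h * 8) (≤-pred (m%n<n m 8)) ⟩
    7 + h * 8              ≤⟨ +-monoˡ-≤ (h * 8) (*-monoʳ-≤ 7 1≤h) ⟩
    7 * h + h * 8          ≡⟨ identity h ⟩
    15 * h                 ∎

-- Transfer to rational and real inequalities.

-- The operation `ℚ./` cancels a gcd, which is stuck on variables. In unnormalised form numerators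
-- and denominators multiply directly, so inequalities become cross-multiplications.
fraction*-toℚᵘ : ∀ c d-1 a → ℚ.toℚᵘ ((+ c ℚ./ suc d-1) ℚ.* (+ a ℚ./ 1)) ℚᵘ.≃ mkℚᵘ (+ c) d-1 ℚᵘ.* mkℚᵘ (+ a) 0
fraction*-toℚᵘ c d-1 a = ℚᵘ.≃-trans (ℚ.toℚᵘ-homo-* (+ c ℚ./ suc d-1) (+ a ℚ./ 1))
  (ℚᵘ.*-cong (ℚ.toℚᵘ-fromℚᵘ (mkℚᵘ (+ c) d-1)) (ℚ.toℚᵘ-fromℚᵘ (mkℚᵘ (+ a) 0)))

-- This and `pos-*-comm` match the two sides of the natural number inequality with the cross
-- products that the unnormalised order compares, including their factors 1.
pos-*-*1 : ∀ c a → + (c * a) ≡ (+ c ℤ.* + a) ℤ.* + 1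
pos-*-*1 c a = trans (ℤ.pos-* c a) (sym (ℤ.*-identityʳ (+ c ℤ.* + a)))

pos-*-comm : ∀ d b → + (d * b) ≡ + b ℤ.* + (d * 1)
pos-*-comm d b = trans (ℤ.pos-* d b) (trans (ℤ.*-comm (+ d) (+ b)) (cong (λ x → + b ℤ.* + x) (sym (*-identityʳ d))))

fraction*-≤ : ∀ c d a b .{{_ : NonZero d}} → c * a ≤ d * b → (+ c ℚ./ d) ℚ.* (+ a ℚ./ 1) ℚ.≤ + b ℚ./ 1
fraction*-≤ c d@(suc d-1) a b ca≤db = ℚ.toℚᵘ-cancel-≤ (begin
  ℚ.toℚᵘ ((+ c ℚ./ d) ℚ.* (+ a ℚ./ 1))      ≃⟨ fraction*-toℚᵘ c d-1 a ⟩
  mkℚᵘ (+ c) d-1 ℚᵘ.* mkℚᵘ (+ a) 0          ≤⟨ ℚᵘ.*≤* (subst₂ ℤ._≤_ (pos-*-*1 c a) (pos-*-comm d b) (ℤ.+≤+ ca≤db)) ⟩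
  mkℚᵘ (+ b) 0                              ≃⟨ ℚ.toℚᵘ-fromℚᵘ (mkℚᵘ (+ b) 0) ⟨
  ℚ.toℚᵘ (+ b ℚ./ 1)                        ∎)
  where open ℚᵘ.≤-Reasoning

≤-fraction* : ∀ c d a b .{{_ : NonZero d}} → d * b ≤ c * a → + b ℚ./ 1 ℚ.≤ (+ c ℚ./ d) ℚ.* (+ a ℚ./ 1)
≤-fraction* c d@(suc d-1) a b db≤ca = ℚ.toℚᵘ-cancel-≤ (begin
  ℚ.toℚᵘ (+ b ℚ./ 1)                        ≃⟨ ℚ.toℚᵘ-fromℚᵘ (mkℚᵘ (+ b) 0) ⟩
  mkℚᵘ (+ b) 0                              ≤⟨ ℚᵘ.*≤* (subst₂ ℤ._≤_ (pos-*-comm d b) (pos-*-*1 c a) (ℤ.+≤+ db≤ca)) ⟩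
  mkℚᵘ (+ c) d-1 ℚᵘ.* mkℚᵘ (+ a) 0          ≃⟨ fraction*-toℚᵘ c d-1 a ⟨
  ℚ.toℚᵘ ((+ c ℚ./ d) ℚ.* (+ a ℚ./ 1))      ∎)
  where open ℚᵘ.≤-Reasoning

≤⇒≤ᵣ : ∀ x y → (∀ i → seq x i ℚ.≤ seq y i) → x ≤ᵣ y
≤⇒≤ᵣ x y x≤y ε 0<ε = 0 , λ i _ →
  subst (ℚ._≤ seq y i ℚ.+ ε) (ℚ.+-identityʳ (seq x i)) (ℚ.+-mono-≤ (x≤y i) (ℚ.<⇒≤ 0<ε))

fromℚ-<ᵣ : ∀ {p q} ε → 0ℚ ℚ.< ε → p ℚ.+ ε ℚ.≤ q → fromℚ p <ᵣ fromℚ q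
fromℚ-<ᵣ ε 0<ε p+ε≤q = ε , 0<ε , 0 , λ _ _ → p+ε≤q

-- All the sequences are constant, so one rational inequality serves every index.
fraction*ᵣ-≤ᵣ : ∀ c d a b .{{_ : NonZero d}} → c * a ≤ d * b → fromℚ (+ c ℚ./ d) *ᵣ fromℕ a ≤ᵣ fromℕ b
fraction*ᵣ-≤ᵣ c d a b ca≤db = ≤⇒≤ᵣ (fromℚ (+ c ℚ./ d) *ᵣ fromℕ a) (fromℕ b) (λ _ → fraction*-≤ c d a b ca≤db)

≤ᵣ-fraction*ᵣ : ∀ c d a b .{{_ : NonZero d}} → d * b ≤ c * a → fromℕ b ≤ᵣ fromℚ (+ c ℚ./ d) *ᵣ fromℕ a
≤ᵣ-fraction*ᵣ c d a b db≤ca = ≤⇒≤ᵣ (fromℕ b) (fromℚ (+ c ℚ./ d) *ᵣ fromℕ a) (λ _ → ≤-fraction* c d a b db≤ca)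

theorem4p1 : Σ[ c₁ ∈ ℝ ] Σ[ c₂ ∈ ℝ ] (0ᵣ <ᵣ c₁ × c₁ <ᵣ c₂ × c₂ <ᵣ 1ᵣ ×
    Σ[ n₀ ∈ ℕ ] (∀ (n : ℕ) → 1 ≤ n → n₀ ≤ n →
    c₁ *ᵣ fromℕ (f₁ n) ≤ᵣ fromℕ (f₄ n) ×
    fromℕ (f₄ n) ≤ᵣ c₂ *ᵣ fromℕ (f₁ n)))
theorem4p1 = fromℚ (+ 1 ℚ./ 6750) , fromℚ (+ 3 ℚ./ 4)
  -- The order `<ᵣ` asks for an explicit rational gap. Here it is the constant 1/6750 itself; in the
  -- next two comparisons 1/4 serves, with equality in `3/4 + 1/4 = 1`. Closed rational comparisons
  -- are settled by their deciders.
  , fromℚ-<ᵣ (+ 1 ℚ./ 6750) (from-yes (0ℚ ℚ.<? + 1 ℚ./ 6750)) (from-yes (0ℚ ℚ.+ + 1 ℚ./ 6750 ℚ.≤? + 1 ℚ./ 6750))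
  , fromℚ-<ᵣ (+ 1 ℚ./ 4) (from-yes (0ℚ ℚ.<? + 1 ℚ./ 4)) (from-yes (+ 1 ℚ./ 6750 ℚ.+ + 1 ℚ./ 4 ℚ.≤? + 3 ℚ./ 4))
  , fromℚ-<ᵣ (+ 1 ℚ./ 4) (from-yes (0ℚ ℚ.<? + 1 ℚ./ 4)) (from-yes (+ 3 ℚ./ 4 ℚ.+ + 1 ℚ./ 4 ℚ.≤? ℚ.1ℚ))
  , 10 , λ n _ 10≤n → fraction*ᵣ-≤ᵣ 1 6750 (f₁ n) (f₄ n) (f₁≤6750*f₄ n 10≤n)
                    , ≤ᵣ-fraction*ᵣ 3 4 (f₁ n) (f₄ n) (f₄-upper n (≤-trans (m≤m+n 5 5) 10≤n))
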